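{- Let $\mathsf{CS}$ be a constant specification for $\mathsf{LP}^B$. Every polynomial $\mathsf{LP}^B_{\mathsf{CS}}$ algebra is bi-isomorphic to a polynomial $\mathsf{LP}^B_{\mathsf{CS}}$ set algebra.
   Context: **Language of $\mathsf{LP}^B$.** Let $\mathsf{Const}$, $\mathsf{Var}$, $\mathsf{Prop}$ be the sets of proof constants, proof variables and propositional atoms; $\mathbf 0$ is a distinguished term symbol not in $\mathsf{Const}$. Terms ($\mathsf{Term}$) and formulas ($\mathsf{Form}$): $s,t ::= c\mid x\mid \mathbf 0\mid -t\mid t+s\mid t\cdot s\mid\,!t$ and $\varphi,\psi ::= p\mid t\approx s\mid\bot\mid\neg\varphi\mid\varphi\vee\psi\mid t:\varphi$, with $c\in\mathsf{Const}$, $x\in\mathsf{Var}$, $p\in\mathsf{Prop}$. Abbreviations: $\mathbf 1:=-\mathbf 0$, $s\odot t:=-(-s+-t)$, $\varphi\to\psi:=\neg\varphi\vee\psi$; $\wedge,\leftrightarrow$ as usual. **Logic.** Axiom schemes of $\mathsf{LP}^B_\emptyset$: $\varphi\to(\varphi\vee\psi)$; $(\varphi\vee\psi)\to(\psi\vee\varphi)$; $(\varphi\vee\varphi)\to\varphi$; $(\varphi\to\psi)\to((\chi\vee\varphi)\to(\chi\vee\psi))$; $\bot\to\varphi$; $s:(\varphi\to\psi)\to(t:\varphi\to(s\cdot t):\psi)$; $(s:\varphi\vee t:\varphi)\to(s+t):\varphi$; $t:\varphi\to\varphi$; $t:\varphi\to\,!t:t:\varphi$; the Boolean axioms for terms: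 $s+t\approx t+s$, $s\odot t\approx t\odot s$, $s+(t+u)\approx(s+t)+u$, $s\odot(t\odot u)\approx(s\odot t)\odot u$, $s+\mathbf 0\approx s$, $s\odot\mathbf 1\approx s$, $s+(-s)\approx\mathbf 1$, $s\odot(-s)\approx\mathbf 0$, $s+(t\odot u)\approx(s+t)\odot(s+u)$, $s\odot(t+u)\approx(s\odot t)+(s\odot u)$; and equality axioms $t\approx t$ and $(s\approx t\wedge\varphi[x/s])\to\varphi[x/t]$, where $\varphi[x/s]$ is the result of substituting $s$ for $x$ in $\varphi$. A constant specification $\mathsf{CS}$ for $\mathsf{LP}^B$ is a set of formulas $c:\varphi$ with $c\in\mathsf{Const}$ and $\varphi$ an axiom instance. $\mathsf{LP}^B_{\mathsf{CS}}$ adds the formulas of $\mathsf{CS}$ as axioms; its rules are Modus Ponens and Int: from $\varphi$ infer $\mathbf 1:\varphi$. **Boolean algebras** are written $(A,0,\ominus,\oplus)$ (least element, complement, join), with $1:=\ominus 0$, $a\otimes b:=\ominus(\ominus a\oplus\ominus b)$, $a\Rightarrow b:=\ominus a\oplus b$, $a\le b$ iff $a\Rightarrow b=1$. **Polynomials.** Let $\mathcal{T}=(T,0_{\mathcal T},-_{\mathcal T},+_{\mathcal T},\cdot_{\mathcal T},!_{\mathcal T})$ where $(T,0_{\mathcal T},-_{\mathcal T},+_{\mathcal T})$ is a Boolean algebra, $\cdot_{\mathcal T}:T\times T\to T$, $!_{\mathcal T}:T\to T$; $1_{\mathcal T}:=-_{\mathcal T}0_{\mathcal T}$. $T[\mathsf{Var}]$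 is the set of (Boolean) polynomials with variables in $\mathsf{Var}$ and coefficients in $T$. Two polynomials are equal, $f\stackrel{p}{=}g$, iff $v(f)=v(g)$ for every $v:\mathsf{Var}\to T$, where $v(f)$ is obtained by replacing every occurrence of every variable by its image under $v$. The Boolean structure of $T$ induces a Boolean algebra $(T[\mathsf{Var}],0_{\mathcal T},-_{\mathcal T[\mathsf{Var}]},+_{\mathcal T[\mathsf{Var}]})$. $\mathcal T[\mathsf{Var}]$ denotes this Boolean algebra together with operations $\cdot_{\mathcal T[\mathsf{Var}]}:T[\mathsf{Var}]\times T[\mathsf{Var}]\to T[\mathsf{Var}]$ and $!_{\mathcal T[\mathsf{Var}]}:T[\mathsf{Var}]\to T[\mathsf{Var}]$ which are arbitrary extensions of $\cdot_{\mathcal T}$ and $!_{\mathcal T}$. **Pre polynomial $\mathsf{LP}^B_{\mathsf{CS}}$ algebra** (over $\mathcal T[\mathsf{Var}]$): a tuple $\mathcal{A}=(A,0,\ominus,\oplus,\Box_\alpha,I)_{\alpha\in T[\mathsf{Var}]}$ where $(A,0,\ominus,\oplus)$ is a Boolean algebra, $I:\mathsf{Const}\cup\{\mathbf 0\}\to T$ with $I(\mathbf 0)=0_{\mathcal T}$, and functions $\Box_\alpha:\mathsf{Form}\to A$ satisfy, for all $\varphi,\psi\in\mathsf{Form}$ and $\alpha,\beta\in T[\mathsf{Var}]$: $\Box_\alpha(\varphi\to\psi)\otimes\Box_\beta(\varphi)\le\Box_{\alpha\cdot_{\mathcal T[\mathsf{Var}]}\beta}(\psi)$; $\Box_\alpha(\varphi)\oplus\Box_\beta(\varphi)\le\Box_{\alpha+_{\mathcal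 T[\mathsf{Var}]}\beta}(\varphi)$; $\Box_{1_{\mathcal T}}(\varphi)=1$ whenever $\vdash_{\mathsf{LP}^B_{\mathsf{CS}}}\varphi$; $\Box_{I(c)}(\varphi)=1$ whenever $c:\varphi\in\mathsf{CS}$. **Assignment.** $\tilde I:\mathsf{Term}\to T[\mathsf{Var}]$: $\tilde I(x)=x$ for $x\in\mathsf{Var}$; $\tilde I(c)=I(c)$ for $c\in\mathsf{Const}\cup\{\mathbf 0\}$; $\tilde I(s\ast t)=\tilde I(s)\ast_{\mathcal T[\mathsf{Var}]}\tilde I(t)$ for $\ast\in\{+,\cdot\}$; $\tilde I(\ast s)=\ast_{\mathcal T[\mathsf{Var}]}\tilde I(s)$ for $\ast\in\{ -,!\}$. For a valuation $\theta:\mathsf{Prop}\to A$, $\tilde\theta:\mathsf{Form}\to A$ is given by $\tilde\theta(p)=\theta(p)$, $\tilde\theta(\bot)=0$, $\tilde\theta(\neg\varphi)=\ominus\tilde\theta(\varphi)$, $\tilde\theta(\varphi\vee\psi)=\tilde\theta(\varphi)\oplus\tilde\theta(\psi)$ (so $\tilde\theta(\varphi\to\psi)=\tilde\theta(\varphi)\Rightarrow\tilde\theta(\psi)$), $\tilde\theta(t:\varphi)=\Box_{\tilde I(t)}(\varphi)$, and $\tilde\theta(s\approx t)=1$ if $\tilde I(s)\stackrel{p}{=}\tilde I(t)$, $=0$ otherwise. **Polynomial $\mathsf{LP}^B_{\mathsf{CS}}$ algebra:** a pre polynomial $\mathsf{LP}^B_{\mathsf{CS}}$ algebra such that for all $\varphi\in\mathsf{Form}$,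 all $t\in\mathsf{Term}$, all $\alpha\in T[\mathsf{Var}]$ and all valuations $\theta:\mathsf{Prop}\to A$: $\Box_{\tilde I(t)}(\varphi)\le\Box_{!_{\mathcal T[\mathsf{Var}]}\tilde I(t)}(t:\varphi)$ and $\Box_\alpha(\varphi)\le\tilde\theta(\varphi)$. **Set algebras.** A set algebra is a subalgebra of a power set algebra $(\mathcal{P}(X),\emptyset,\setminus,\cup)$, $\setminus$ being complement relative to $X$. A polynomial $\mathsf{LP}^B_{\mathsf{CS}}$ set algebra is a polynomial $\mathsf{LP}^B_{\mathsf{CS}}$ algebra $(A,\emptyset,\setminus,\cup,\Box_\alpha,I)_{\alpha\in B[\mathsf{Var}]}$ over $\mathcal B[\mathsf{Var}]$, with $\mathcal B=(B,\emptyset,\setminus,\cup,\cdot_{\mathcal B},!_{\mathcal B})$, where both $(A,\emptyset,\setminus,\cup)$ and $(B,\emptyset,\setminus,\cup)$ are set algebras. **Bi-isomorphism** between polynomial $\mathsf{LP}^B_{\mathsf{CS}}$ algebras $\mathcal A$ over $\mathcal T[\mathsf{Var}]$ and $\mathcal A'$ over $\mathcal T'[\mathsf{Var}]$: a pair $(f,g)$ of Boolean isomorphisms $f:(A,0,\ominus,\oplus)\to(A',0',\ominus',\oplus')$ and $g:(T,0_{\mathcal T},-_{\mathcal T},+_{\mathcal T})\to(T',0_{\mathcal T'},-_{\mathcal T'},+_{\mathcal T'})$, with $g$ extended to $g:T[\mathsf{Var}]\to T'[\mathsf{Var}]$ by $g(x)=x$ for $x\in\mathsf{Var}$, such that $f(\Box_\alpha(\varphi))=\Box'_{g(\alpha)}(\varphi)$,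 $g(I(c))=I'(c)$, $g(\alpha\cdot_{\mathcal T[\mathsf{Var}]}\beta)=g(\alpha)\cdot_{\mathcal T'[\mathsf{Var}]}g(\beta)$, $g(!_{\mathcal T[\mathsf{Var}]}\alpha)=\,!_{\mathcal T'[\mathsf{Var}]}g(\alpha)$ for all $\alpha,\beta\in T[\mathsf{Var}]$, $\varphi\in\mathsf{Form}$, $c\in\mathsf{Const}\cup\{\mathbf 0\}$. -}

module Defs where

open import Level using (Level; Setω; 0ℓ; _⊔_) renaming (suc to lsuc)
open import Algebra.Core using (Op₁; Op₂)
open import Algebra.Definitions using (Congruent₁; Congruent₂)
open import Algebra.Lattice.Bundles using (BooleanAlgebra)
open import Algebra.Lattice.Structures.Biased using (isBooleanAlgebraʳ)
open import Axiom.ExcludedMiddle using (ExcludedMiddle)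
open import Data.Bool.Base using (if_then_else_)
open import Data.Empty using (⊥-elim)
open import Data.Maybe.Base using (Maybe; just; nothing)
open import Data.Product.Base using (Σ; Σ-syntax; ∃; ∃-syntax; _×_; _,_; proj₁; proj₂)
open import Data.Sum.Base using (inj₁; inj₂)
open import Data.Unit.Base using (tt)
open import Function.Bundles using (Func; _⟨$⟩_)
open import Relation.Binary.Bundles using (Setoid)
open import Relation.Binary.Core using (Rel; REL)
open import Relation.Binary.Morphism.Structures using (IsRelIsomorphism)
open import Relation.Binary.PropositionalEquality.Core using (_≡_)
open import Relation.Nullary.Decidable.Core using (yes; no; does)
open import Relation.Unary using (Pred; _∈_; _≐_; ∅; U; ∁; _∪_; _∩_)
import Relation.Unary.Algebra as Subset
import Relation.Unary.Properties as Subsetₚ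

-- Sets with equality are setoids, so the axiom of choice is stated in its
-- extensional form: the choice function respects the setoid equalities.
-- (Without that requirement choice is a triviality of type theory.)

AxiomOfChoice : Setω
AxiomOfChoice =
  ∀ {a ℓa b ℓb r : Level} (X : Setoid a ℓa) (Y : Setoid b ℓb)
    (R : REL (Setoid.Carrier X) (Setoid.Carrier Y) r) →
  (∀ {x x′ y y′} → Setoid._≈_ X x x′ → Setoid._≈_ Y y y′ → R x y → R x′ y′) →
  (∀ x → ∃ λ y → R x y) →
  Σ[ f ∈ Func X Y ] (∀ x → R x (f ⟨$⟩ x))

-- The library bundle also carries a meet and a top; the notions below are
-- expressed through bottom, complement and join alone.

module BooleanNotation {a ℓ : Level} (A : BooleanAlgebra a ℓ) where
  open BooleanAlgebra A

  infixr 7 _⊗_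
  infixr 6 _⊕_
  infixr 5 _⇒_
  infix  4 _≤_

  𝟘 𝟙 : Carrier
  𝟘 = ⊥
  𝟙 = ¬ ⊥

  ⊖ : Op₁ Carrier
  ⊖ x = ¬ x

  _⊕_ _⊗_ _⇒_ : Op₂ Carrier
  x ⊕ y = x ∨ y
  x ⊗ y = ⊖ (⊖ x ⊕ ⊖ y)
  x ⇒ y = ⊖ x ⊕ y

  _≤_ : Rel Carrier ℓ
  x ≤ y = (x ⇒ y) ≈ 𝟙

module _ {a ℓ b ℓ′ : Level} (A : BooleanAlgebra a ℓ) (B : BooleanAlgebra b ℓ′) where
  private
    module A = BooleanAlgebra A
    module B = BooleanAlgebra B
    module NA = BooleanNotation A
    module NB = BooleanNotation B

  record IsBooleanIsomorphism (f : A.Carrier → B.Carrier) : Set (a ⊔ ℓ ⊔ b ⊔ ℓ′) where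
    field
      isRelIsomorphism : IsRelIsomorphism A._≈_ B._≈_ f
      𝟘-homo : f NA.𝟘 B.≈ NB.𝟘
      ⊖-homo : ∀ x → f (NA.⊖ x) B.≈ NB.⊖ (f x)
      ⊕-homo : ∀ x y → f (x NA.⊕ y) B.≈ f x NB.⊕ f y

-- Under excluded middle every subset of X, whatever its universe level, is
-- extensionally equal to an element of Pred X 0ℓ, which therefore serves as
-- the power set of X.

record SetAlgebra (x m : Level) : Set (lsuc (x ⊔ m ⊔ lsuc 0ℓ)) where
  field
    X        : Set x
    Member   : Pred (Pred X 0ℓ) m
    resp     : ∀ {P Q} → P ≐ Q → P ∈ Member → Q ∈ Member
    ∅-closed : ∅ ∈ Member
    ∁-closed : ∀ {P} → P ∈ Member → ∁ P ∈ Member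
    ∪-closed : ∀ {P Q} → P ∈ Member → Q ∈ Member → (P ∪ Q) ∈ Member

module _ (em : ∀ {ℓ} → ExcludedMiddle ℓ) where

  setBooleanAlgebra : ∀ {x m : Level} → SetAlgebra x m →
                      BooleanAlgebra (lsuc 0ℓ ⊔ x ⊔ m) x
  setBooleanAlgebra S = record
    { Carrier = ∃ Member
    ; _≈_     = λ P Q → proj₁ P ≐ proj₁ Q
    ; _∨_     = λ (P , p) (Q , q) → (P ∪ Q) , ∪-closed p q
    ; _∧_     = λ (P , p) (Q , q) → (P ∩ Q) , ∩-closed p q
    ; ¬_      = λ (P , p) → ∁ P , ∁-closed p
    ; ⊤       = U , U-closed
    ; ⊥       = ∅ , ∅-closed
    ; isBooleanAlgebra = isBooleanAlgebraʳ record
      { isDistributiveLattice = record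
        { isLattice = record
          { isEquivalence = record
            { refl  = Subsetₚ.≐-refl
            ; sym   = Subsetₚ.≐-sym
            ; trans = Subsetₚ.≐-trans
            }
          ; ∨-comm  = λ P Q → Subset.∪-comm (proj₁ P) (proj₁ Q)
          ; ∨-assoc = λ P Q R → Subset.∪-assoc (proj₁ P) (proj₁ Q) (proj₁ R)
          ; ∨-cong  = λ {P} {Q} {R} {S} →
              Subset.∪-cong {x = proj₁ P} {proj₁ Q} {proj₁ R} {proj₁ S}
          ; ∧-comm  = λ P Q → Subset.∩-comm (proj₁ P) (proj₁ Q)
          ; ∧-assoc = λ P Q R → Subset.∩-assoc (proj₁ P) (proj₁ Q) (proj₁ R)
          ; ∧-cong  = λ {P} {Q} {R} {S} →
              Subset.∩-cong {x = proj₁ P} {proj₁ Q} {proj₁ R} {proj₁ S}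
          ; absorptive =
              (λ P Q → Subset.∪-abs-∩ (proj₁ P) (proj₁ Q))
            , (λ P Q → Subset.∩-abs-∪ (proj₁ P) (proj₁ Q))
          }
        ; ∨-distrib-∧ =
            (λ P Q R → Subset.∪-distribˡ-∩ (proj₁ P) (proj₁ Q) (proj₁ R))
          , (λ P Q R → Subset.∪-distribʳ-∩ (proj₁ P) (proj₁ Q) (proj₁ R))
        ; ∧-distrib-∨ =
            (λ P Q R → Subset.∩-distribˡ-∪ (proj₁ P) (proj₁ Q) (proj₁ R))
          , (λ P Q R → Subset.∩-distribʳ-∪ (proj₁ P) (proj₁ Q) (proj₁ R))
        }
      ; ∨-complementʳ = λ P → (λ _ → tt) , (λ {z} _ → split (proj₁ P) z)
      ; ∧-complementʳ = λ P → (λ (y , n) → n y) , λ ()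
      ; ¬-cong        = λ (to , from) → (λ n y → n (from y)) , (λ n y → n (to y))
      }
    }
    where
    open SetAlgebra S

    split : ∀ P z → z ∈ (P ∪ ∁ P)
    split P z with em {_} {P z}
    ... | yes y = inj₁ y
    ... | no  n = inj₂ n

    U-closed : U ∈ Member
    U-closed = resp ((λ _ → tt) , (λ _ ())) (∁-closed ∅-closed)

    ∩-closed : ∀ {P Q} → P ∈ Member → Q ∈ Member → (P ∩ Q) ∈ Member
    ∩-closed {P} {Q} p q =
      resp (from , λ (y , z) → λ { (inj₁ n) → n y ; (inj₂ n) → n z })
           (∁-closed (∪-closed (∁-closed p) (∁-closed q)))
      where
      from : ∀ {z} → z ∈ ∁ (∁ P ∪ ∁ Q) → z ∈ (P ∩ Q)
      from {z} n with split P z | split Q z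
      ... | inj₁ y | inj₁ y′ = y , y′
      ... | inj₂ k | _       = ⊥-elim (n (inj₁ k))
      ... | inj₁ _ | inj₂ k  = ⊥-elim (n (inj₂ k))

module Polynomials {v : Level} (Var : Set v) where

  data Poly {t : Level} (T : Set t) : Set (v ⊔ t) where
    var  : Var → Poly T
    coef : T → Poly T
    -ᵖ_  : Poly T → Poly T
    _+ᵖ_ : Poly T → Poly T → Poly T

  mapCoef : ∀ {t t′ : Level} {T : Set t} {T′ : Set t′} → (T → T′) → Poly T → Poly T′
  mapCoef g (var x)  = var x
  mapCoef g (coef a) = coef (g a)
  mapCoef g (-ᵖ α)   = -ᵖ mapCoef g α
  mapCoef g (α +ᵖ β) = mapCoef g α +ᵖ mapCoef g β

  module PolynomialEquality {t ℓ : Level} (T : BooleanAlgebra t ℓ) where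
    open BooleanAlgebra T
    open BooleanNotation T

    eval : (Var → Carrier) → Poly Carrier → Carrier
    eval ν (var x)  = ν x
    eval ν (coef a) = a
    eval ν (-ᵖ α)   = ⊖ (eval ν α)
    eval ν (α +ᵖ β) = eval ν α ⊕ eval ν β

    infix 4 _=ᵖ_
    _=ᵖ_ : Rel (Poly Carrier) (v ⊔ t ⊔ ℓ)
    α =ᵖ β = ∀ (ν : Var → Carrier) → eval ν α ≈ eval ν β

  -- The polynomial operations extend those on T but are otherwise
  -- arbitrary: they need not act coefficientwise.

  record PolynomialOperations {t ℓ : Level} (T : BooleanAlgebra t ℓ) : Set (v ⊔ t ⊔ ℓ) where
    open BooleanAlgebra T using (Carrier; _≈_)
    open PolynomialEquality T public
    infixl 7 _·ᵀ_ _·ᵖ_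
    field
      _·ᵀ_     : Op₂ Carrier
      !ᵀ       : Op₁ Carrier
      ·ᵀ-cong  : Congruent₂ _≈_ _·ᵀ_
      !ᵀ-cong  : Congruent₁ _≈_ !ᵀ
      _·ᵖ_     : Op₂ (Poly Carrier)
      !ᵖ       : Op₁ (Poly Carrier)
      ·ᵖ-cong  : Congruent₂ _=ᵖ_ _·ᵖ_
      !ᵖ-cong  : Congruent₁ _=ᵖ_ !ᵖ
      ·-extend : ∀ a b → (coef a ·ᵖ coef b) =ᵖ coef (a ·ᵀ b)
      !-extend : ∀ a → !ᵖ (coef a) =ᵖ coef (!ᵀ a)

-- Excluded middle decides equality of variables in substitutions and
-- equality of polynomials in the truth value of s ≋ t.

module LPB (em : ∀ {ℓ} → ExcludedMiddle ℓ)
           {c v p : Level} (Const : Set c) (Var : Set v) (Prop′ : Set p) where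

  open Polynomials Var public using (Poly; coef; mapCoef; PolynomialOperations)
  open Polynomials Var using (-ᵖ_; _+ᵖ_)

  infix  9 -_ !_
  infixl 8 _·_
  infixl 7 _+_ _⊙_

  data Term : Set (c ⊔ v) where
    con : Const → Term
    var : Var → Term
    𝟎   : Term
    -_  : Term → Term
    _+_ : Term → Term → Term
    _·_ : Term → Term → Term
    !_  : Term → Term

  𝟏 : Term
  𝟏 = - 𝟎

  _⊙_ : Term → Term → Term
  s ⊙ t = - ((- s) + (- t))

  infix  6 _≋_
  infixr 5 _∶_
  infix  5 ¬ᶠ_
  infixr 4 _∧ᶠ_
  infixr 3 _∨ᶠ_
  infixr 2 _→ᶠ_

  data Form : Set (c ⊔ v ⊔ p) where
    atom : Prop′ → Form
    _≋_  : Term → Term → Form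
    ⊥ᶠ   : Form
    ¬ᶠ_  : Form → Form
    _∨ᶠ_ : Form → Form → Form
    _∶_  : Term → Form → Form

  _→ᶠ_ _∧ᶠ_ : Form → Form → Form
  φ →ᶠ ψ = (¬ᶠ φ) ∨ᶠ ψ
  φ ∧ᶠ ψ = ¬ᶠ ((¬ᶠ φ) ∨ᶠ (¬ᶠ ψ))

  substTerm : Var → Term → Term → Term
  substTerm x s (con k) = con k
  substTerm x s (var y) = if does (em {_} {x ≡ y}) then s else var y
  substTerm x s 𝟎       = 𝟎
  substTerm x s (- t)   = - substTerm x s t
  substTerm x s (t + u) = substTerm x s t + substTerm x s u
  substTerm x s (t · u) = substTerm x s t · substTerm x s u
  substTerm x s (! t)   = ! substTerm x s t

  infix 10 _[_/_]
  _[_/_] : Form → Var → Term → Form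
  (atom q)  [ x / s ] = atom q
  (t ≋ u)   [ x / s ] = substTerm x s t ≋ substTerm x s u
  ⊥ᶠ        [ x / s ] = ⊥ᶠ
  (¬ᶠ φ)    [ x / s ] = ¬ᶠ (φ [ x / s ])
  (φ ∨ᶠ ψ)  [ x / s ] = (φ [ x / s ]) ∨ᶠ (ψ [ x / s ])
  (t ∶ φ)   [ x / s ] = substTerm x s t ∶ (φ [ x / s ])

  data Axiom : Form → Set (c ⊔ v ⊔ p) where
    ∨-intro   : ∀ φ ψ → Axiom (φ →ᶠ (φ ∨ᶠ ψ))
    ∨-swap    : ∀ φ ψ → Axiom ((φ ∨ᶠ ψ) →ᶠ (ψ ∨ᶠ φ))
    ∨-idem    : ∀ φ → Axiom ((φ ∨ᶠ φ) →ᶠ φ)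
    ∨-mono    : ∀ φ ψ χ → Axiom ((φ →ᶠ ψ) →ᶠ ((χ ∨ᶠ φ) →ᶠ (χ ∨ᶠ ψ)))
    ex-falso  : ∀ φ → Axiom (⊥ᶠ →ᶠ φ)
    applic    : ∀ s t φ ψ → Axiom ((s ∶ (φ →ᶠ ψ)) →ᶠ ((t ∶ φ) →ᶠ ((s · t) ∶ ψ)))
    sum       : ∀ s t φ → Axiom (((s ∶ φ) ∨ᶠ (t ∶ φ)) →ᶠ ((s + t) ∶ φ))
    reflect   : ∀ t φ → Axiom ((t ∶ φ) →ᶠ φ)
    introsp   : ∀ t φ → Axiom ((t ∶ φ) →ᶠ ((! t) ∶ (t ∶ φ)))
    +-comm    : ∀ s t → Axiom ((s + t) ≋ (t + s))
    ⊙-comm    : ∀ s t → Axiom ((s ⊙ t) ≋ (t ⊙ s))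
    +-assoc   : ∀ s t u → Axiom ((s + (t + u)) ≋ ((s + t) + u))
    ⊙-assoc   : ∀ s t u → Axiom ((s ⊙ (t ⊙ u)) ≋ ((s ⊙ t) ⊙ u))
    +-unit    : ∀ s → Axiom ((s + 𝟎) ≋ s)
    ⊙-unit    : ∀ s → Axiom ((s ⊙ 𝟏) ≋ s)
    +-compl   : ∀ s → Axiom ((s + (- s)) ≋ 𝟏)
    ⊙-compl   : ∀ s → Axiom ((s ⊙ (- s)) ≋ 𝟎)
    +-distr-⊙ : ∀ s t u → Axiom ((s + (t ⊙ u)) ≋ ((s + t) ⊙ (s + u)))
    ⊙-distr-+ : ∀ s t u → Axiom ((s ⊙ (t + u)) ≋ ((s ⊙ t) + (s ⊙ u)))
    ≋-refl    : ∀ t → Axiom (t ≋ t)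
    ≋-subst   : ∀ s t x φ → Axiom (((s ≋ t) ∧ᶠ (φ [ x / s ])) →ᶠ (φ [ x / t ]))

  record ConstantSpecification (m : Level) : Set (c ⊔ v ⊔ p ⊔ lsuc m) where
    field
      CS      : Pred Form m
      CS-spec : ∀ {χ} → χ ∈ CS → ∃[ k ] ∃[ φ ] (χ ≡ (con k ∶ φ)) × Axiom φ

  module _ {m : Level} (𝒞 : ConstantSpecification m) where
    open ConstantSpecification 𝒞

    infix 1 ⊢_
    data ⊢_ : Form → Set (c ⊔ v ⊔ p ⊔ m) where
      axiom : ∀ {φ} → Axiom φ → ⊢ φ
      spec  : ∀ {χ} → χ ∈ CS → ⊢ χ
      mp    : ∀ {φ ψ} → ⊢ (φ →ᶠ ψ) → ⊢ φ → ⊢ ψ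
      int   : ∀ {φ} → ⊢ φ → ⊢ (𝟏 ∶ φ)

    record PrePolynomialStructure
             {t ℓt a ℓa : Level} {T : BooleanAlgebra t ℓt} (𝒯 : PolynomialOperations T)
             (A : BooleanAlgebra a ℓa) : Set (c ⊔ v ⊔ p ⊔ m ⊔ t ⊔ ℓt ⊔ a ⊔ ℓa) where
      private
        module T  = BooleanAlgebra T
        module TN = BooleanNotation T
        module A  = BooleanAlgebra A
      open PolynomialOperations 𝒯
      open BooleanNotation A

      field
        I : Maybe Const → T.Carrier   -- nothing stands for the symbol 𝟎
        □ : Poly T.Carrier → Form → A.Carrier

        -- Indices are polynomials up to =ᵖ.
        □-cong : ∀ {α β} φ → α =ᵖ β → □ α φ A.≈ □ β φ

        I-𝟎     : I nothing T.≈ TN.𝟘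
        □-app   : ∀ α β φ ψ → □ α (φ →ᶠ ψ) ⊗ □ β φ ≤ □ (α ·ᵖ β) ψ
        □-sum   : ∀ α β φ → □ α φ ⊕ □ β φ ≤ □ (α +ᵖ β) φ
        □-nec   : ∀ {φ} → ⊢ φ → □ (coef TN.𝟙) φ A.≈ 𝟙
        □-const : ∀ {k φ} → (con k ∶ φ) ∈ CS → □ (coef (I (just k))) φ A.≈ 𝟙

      Ĩ : Term → Poly T.Carrier
      Ĩ (con k) = coef (I (just k))
      Ĩ (var x) = Poly.var x
      Ĩ 𝟎       = coef (I nothing)
      Ĩ (- s)   = -ᵖ Ĩ s
      Ĩ (s + t) = Ĩ s +ᵖ Ĩ t
      Ĩ (s · t) = Ĩ s ·ᵖ Ĩ t
      Ĩ (! s)   = !ᵖ (Ĩ s)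

      ⟦_⟧ : Form → (Prop′ → A.Carrier) → A.Carrier
      ⟦ atom q ⟧ θ  = θ q
      ⟦ s ≋ t ⟧ θ   = if does (em {_} {Ĩ s =ᵖ Ĩ t}) then 𝟙 else 𝟘
      ⟦ ⊥ᶠ ⟧ θ      = 𝟘
      ⟦ ¬ᶠ φ ⟧ θ    = ⊖ (⟦ φ ⟧ θ)
      ⟦ φ ∨ᶠ ψ ⟧ θ  = ⟦ φ ⟧ θ ⊕ ⟦ ψ ⟧ θ
      ⟦ t ∶ φ ⟧ θ   = □ (Ĩ t) φ

    record PolynomialStructure
             {t ℓt a ℓa : Level} {T : BooleanAlgebra t ℓt} (𝒯 : PolynomialOperations T)
             (A : BooleanAlgebra a ℓa) : Set (c ⊔ v ⊔ p ⊔ m ⊔ t ⊔ ℓt ⊔ a ⊔ ℓa) where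
      open PolynomialOperations 𝒯
      open BooleanNotation A
      field
        prePolynomialStructure : PrePolynomialStructure 𝒯 A
      open PrePolynomialStructure prePolynomialStructure public
      field
        □-introsp : ∀ t φ → □ (Ĩ t) φ ≤ □ (!ᵖ (Ĩ t)) (t ∶ φ)
        □-reflect : ∀ α φ (θ : Prop′ → BooleanAlgebra.Carrier A) → □ α φ ≤ ⟦ φ ⟧ θ

    record PolynomialAlgebra (t ℓt a ℓa : Level) :
             Set (c ⊔ v ⊔ p ⊔ m ⊔ lsuc (t ⊔ ℓt ⊔ a ⊔ ℓa)) where
      field
        T : BooleanAlgebra t ℓt
        𝒯 : PolynomialOperations T
        A : BooleanAlgebra a ℓa
        polynomialStructure : PolynomialStructure 𝒯 A
      open PolynomialOperations 𝒯 public
      open PolynomialStructure polynomialStructure public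

    record PolynomialSetAlgebra (x n y k : Level) :
             Set (c ⊔ v ⊔ p ⊔ m ⊔ lsuc (x ⊔ n ⊔ y ⊔ k ⊔ lsuc 0ℓ)) where
      field
        B : SetAlgebra x n
        ℬ : PolynomialOperations (setBooleanAlgebra em B)
        S : SetAlgebra y k
        polynomialStructure : PolynomialStructure ℬ (setBooleanAlgebra em S)

      polynomialAlgebra : PolynomialAlgebra (lsuc 0ℓ ⊔ x ⊔ n) x (lsuc 0ℓ ⊔ y ⊔ k) y
      polynomialAlgebra = record { polynomialStructure = polynomialStructure }

    record BiIsomorphism {t ℓt a ℓa t′ ℓt′ a′ ℓa′ : Level}
             (𝒜 : PolynomialAlgebra t ℓt a ℓa) (𝒜′ : PolynomialAlgebra t′ ℓt′ a′ ℓa′) :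
             Set (c ⊔ v ⊔ p ⊔ t ⊔ ℓt ⊔ a ⊔ ℓa ⊔ t′ ⊔ ℓt′ ⊔ a′ ⊔ ℓa′) where
      private
        module P  = PolynomialAlgebra 𝒜
        module P′ = PolynomialAlgebra 𝒜′
        module A  = BooleanAlgebra P.A
        module T  = BooleanAlgebra P.T
        module A′ = BooleanAlgebra P′.A
        module T′ = BooleanAlgebra P′.T
      field
        f : A.Carrier → A′.Carrier
        g : T.Carrier → T′.Carrier
        f-isBooleanIsomorphism : IsBooleanIsomorphism P.A P′.A f
        g-isBooleanIsomorphism : IsBooleanIsomorphism P.T P′.T g

      ĝ : Poly T.Carrier → Poly T′.Carrier
      ĝ = mapCoef g

      field
        □-homo : ∀ α φ → f (P.□ α φ) A′.≈ P′.□ (ĝ α) φ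
        I-homo : ∀ k → g (P.I k) T′.≈ P′.I k
        ·-homo : ∀ α β → ĝ (α P.·ᵖ β) P′.=ᵖ (ĝ α P′.·ᵖ ĝ β)
        !-homo : ∀ α → ĝ (P.!ᵖ α) P′.=ᵖ P′.!ᵖ (ĝ α)

{-# OPTIONS --safe #-}
module Submission where

-- Both Boolean algebras are replaced by their Stone representations, whose
-- points are the ultrafilters, and all further structure is transported along
-- the Stone isomorphisms; a valuation into the representation is the image of
-- a valuation into the original algebra, so the condition quantifying over
-- valuations is preserved. Ultrafilters come from Zorn's lemma, for which
-- extensional choice picks a proper extension of each non-maximal filter, and
-- the Bourbaki–Witt argument finds a fixpoint of that choice.

open import Defs
open import Level using (Level; _⊔_; 0ℓ)
open import Algebra.Lattice.Bundles using (BooleanAlgebra)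
import Algebra.Lattice.Properties.BooleanAlgebra as BooleanAlgebraProperties
open import Axiom.ExcludedMiddle using (ExcludedMiddle)
open import Data.Bool.Base using (Bool; T)
open import Data.Empty using (⊥-elim)
open import Data.Maybe.Base using (just; nothing)
open import Data.Product.Base using (Σ-syntax; ∃; ∃-syntax; _×_; _,_; proj₁; proj₂; swap)
open import Data.Sum.Base using (_⊎_; inj₁; inj₂; [_,_])
open import Function.Base using (id; _∘_)
open import Function.Bundles using (Func; _⟨$⟩_)
open import Relation.Binary.Bundles using (Setoid)
open import Relation.Binary.Core using (Rel)
open import Relation.Binary.Morphism.Structures using (IsRelIsomorphism)
import Relation.Binary.Reasoning.Setoid as SetoidReasoning
open import Relation.Nullary.Decidable.Core using (yes; no; ⌊_⌋; toWitness; fromWitness)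
open import Relation.Nullary.Negation.Core using (¬_)
open import Relation.Unary using (Pred; _≐_; _⊆_; ∅; ∁; _∪_)
open import Relation.Unary.Properties using (≐-refl; ≐-trans)

-- Boolean-valued subsets of a type, ordered by inclusion.

-- Subsets are Bool-valued so that families of subsets stay in the universe of
-- the underlying type; excluded middle makes this no restriction.
module BooleanSubsets (em : ∀ {ℓ} → ExcludedMiddle ℓ) {a : Level} (A : Set a) where

  Subset : Set a
  Subset = A → Bool

  ⟪_⟫ : ∀ {ℓ} → Pred A ℓ → Subset
  ⟪ P ⟫ x = ⌊ em {P = P x} ⌋

  ⟪⟫⁺ : ∀ {ℓ} (P : Pred A ℓ) {x} → P x → T (⟪ P ⟫ x)
  ⟪⟫⁺ P = fromWitness

  ⟪⟫⁻ : ∀ {ℓ} (P : Pred A ℓ) {x} → T (⟪ P ⟫ x) → P x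
  ⟪⟫⁻ P = toWitness

  infix 4 _⊑_
  _⊑_ : Rel Subset a
  F ⊑ G = ∀ x → T (F x) → T (G x)

  ⊑-trans : ∀ {F G H} → F ⊑ G → G ⊑ H → F ⊑ H
  ⊑-trans F⊑G G⊑H x = G⊑H x ∘ F⊑G x

  subsetSetoid : Setoid a a
  subsetSetoid = record
    { Carrier       = Subset
    ; _≈_           = λ F G → F ⊑ G × G ⊑ F
    ; isEquivalence = record
      { refl  = (λ _ → id) , (λ _ → id)
      ; sym   = swap
      ; trans = λ (p , q) (r , s) → ⊑-trans p r , ⊑-trans s q
      }
    }

  ⋃ : (Subset → Bool) → Subset
  ⋃ C = ⟪ (λ x → ∃[ F ] T (C F) × T (F x)) ⟫

  ⊑⋃ : ∀ C {F} → T (C F) → F ⊑ ⋃ C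
  ⊑⋃ C {F} F∈C x x∈F = ⟪⟫⁺ (λ x → ∃[ F ] T (C F) × T (F x)) (F , F∈C , x∈F)

  ∈⋃ : ∀ C {x} → T (⋃ C x) → ∃[ F ] T (C F) × T (F x)
  ∈⋃ C = ⟪⟫⁻ (λ x → ∃[ F ] T (C F) × T (F x))

  ⋃⊑ : ∀ C {G} → (∀ F → T (C F) → F ⊑ G) → ⋃ C ⊑ G
  ⋃⊑ C C⊑G x x∈⋃ with F , F∈C , x∈F ← ∈⋃ C x∈⋃ = C⊑G F F∈C x x∈F

  Chain : Pred (Subset → Bool) a
  Chain C = ∀ F G → T (C F) → T (C G) → F ⊑ G ⊎ G ⊑ F

  -- The Bourbaki-Witt fixpoint theorem for families of subsets.

  module BourbakiWitt
    (s : Subset → Subset)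
    -- Mutual inclusion stands in for equality of subsets; the congruence of an extensional choice
    -- function is what meets this condition.
    (s-cong : ∀ {F G} → F ⊑ G → G ⊑ F → s F ⊑ s G)
    (s-inflationary : ∀ F → F ⊑ s F)
    (F₀ : Subset) where

    -- `sup` takes unions of arbitrary inhabited families, since comparability of the members is a
    -- consequence (`tower-chain`). Inhabitedness keeps each union above `F₀`.
    data Tower : Pred Subset a where
      base : Tower F₀
      step : ∀ {F} → Tower F → Tower (s F)
      sup  : ∀ C → ∃ (T ∘ C) → (∀ F → T (C F) → Tower F) → Tower (⋃ C)

    base⊑ : ∀ {F} → Tower F → F₀ ⊑ F
    base⊑ base                    = λ _ → id
    base⊑ (step t)                = ⊑-trans (base⊑ t) (s-inflationary _)
    base⊑ (sup C (F , F∈C) tower) = ⊑-trans (base⊑ (tower F F∈C)) (⊑⋃ C F∈C)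

    -- Classically: `s G ⊑ F` for every tower member `G` strictly below `F`. Strictness is expressed
    -- by the alternative `F ⊑ G`.
    Extreme : Pred Subset a
    Extreme F = ∀ {G} → Tower G → G ⊑ F → F ⊑ G ⊎ s G ⊑ F

    -- Induction on `G`. Extremeness enters for a successor of some `G ⊑ F`: either `G` and `F`
    -- coincide, so `s F ⊑ s G`, or `s G` is still below `F`. A union lies below `F` unless one of
    -- its members is already above `s F`.
    extreme-compares : ∀ {F G} → Tower F → Extreme F → Tower G → G ⊑ F ⊎ s F ⊑ G
    extreme-compares f ext base = inj₁ (base⊑ f)
    extreme-compares f ext (step g) with extreme-compares f ext g
    ... | inj₂ sF⊑G = inj₂ (⊑-trans sF⊑G (s-inflationary _))
    ... | inj₁ G⊑F with ext g G⊑F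
    ...   | inj₁ F⊑G  = inj₂ (s-cong F⊑G G⊑F)
    ...   | inj₂ sG⊑F = inj₁ sG⊑F
    extreme-compares {F} f ext (sup C _ tower)
      with em {P = ∃[ G ] T (C G) × s F ⊑ G}
    ... | yes (G , G∈C , sF⊑G) = inj₂ (⊑-trans sF⊑G (⊑⋃ C G∈C))
    ... | no none = inj₁ (⋃⊑ C λ G G∈C →
            [ id , (λ sF⊑G → ⊥-elim (none (G , G∈C , sF⊑G))) ]
            (extreme-compares f ext (tower G G∈C)))

    -- Induction on `F`, with `extreme-compares` applied to the smaller members already known to be
    -- extreme. For a union, if no member contains `G`, then all of them lie below `G`, and so does
    -- the union.
    extreme : ∀ {F} → Tower F → Extreme F
    extreme base g _ = inj₁ (base⊑ g)
    extreme (step f) g G⊑sF with extreme-compares f (extreme f) g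
    ... | inj₂ sF⊑G = inj₁ sF⊑G
    ... | inj₁ G⊑F with extreme f g G⊑F
    ...   | inj₁ F⊑G  = inj₂ (s-cong G⊑F F⊑G)
    ...   | inj₂ sG⊑F = inj₂ (⊑-trans sG⊑F (s-inflationary _))
    extreme (sup C inh tower) {G} g G⊑⋃
      with em {P = ∃[ F ] T (C F) × G ⊑ F}
    ... | no none = inj₁ (⋃⊑ C λ F F∈C →
            [ (λ G⊑F → ⊥-elim (none (F , F∈C , G⊑F))) , ⊑-trans (s-inflationary F) ]
            (extreme-compares (tower F F∈C) (extreme (tower F F∈C)) g))
    ... | yes (F , F∈C , G⊑F) with extreme (tower F F∈C) g G⊑F
    ...   | inj₂ sG⊑F = inj₂ (⊑-trans sG⊑F (⊑⋃ C F∈C))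
    -- `G` and `F` coincide here, so inclusion in `F` does not place `s G`; comparing `F` with the
    -- whole union does.
    ...   | inj₁ F⊑G
          with extreme-compares (tower F F∈C) (extreme (tower F F∈C)) (sup C inh tower)
    ...     | inj₁ ⋃⊑F  = inj₁ (⊑-trans ⋃⊑F F⊑G)
    ...     | inj₂ sF⊑⋃ = inj₂ (⊑-trans (s-cong G⊑F F⊑G) sF⊑⋃)

    tower-chain : ∀ {F G} → Tower F → Tower G → F ⊑ G ⊎ G ⊑ F
    tower-chain f g with extreme-compares f (extreme f) g
    ... | inj₁ G⊑F  = inj₂ G⊑F
    ... | inj₂ sF⊑G = inj₁ (⊑-trans (s-inflationary _) sF⊑G)

    -- The union of the whole tower is itself a member by `sup`, so its image under `s` is a member
    -- too and is contained in that union.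
    tower-fixpoint : ∃[ M ] Tower M × s M ⊑ M
    tower-fixpoint = ⋃ C , M∈Tower , ⊑⋃ C (fromWitness (step M∈Tower))
      where
      C : Subset → Bool
      C F = ⌊ em {P = Tower F} ⌋

      M∈Tower : Tower (⋃ C)
      M∈Tower = sup C (F₀ , fromWitness base) (λ _ → toWitness)

  -- Zorn's lemma for subsets, with unions as bounds of chains.

  module _ {g : Level} (Good : Pred Subset g) where

    Maximal : Pred Subset (a ⊔ g)
    Maximal F = ∀ G → Good G → F ⊑ G → G ⊑ F

    zorn : AxiomOfChoice →
           (∀ {F G} → F ⊑ G → G ⊑ F → Good F → Good G) →
           (∀ C → ∃ (T ∘ C) → Chain C → (∀ F → T (C F) → Good F) → Good (⋃ C)) →
           ∀ F₀ → Good F₀ → ∃[ M ] Good M × F₀ ⊑ M × Maximal M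
    zorn ac Good-resp Good-⋃ F₀ good₀ =
      let M , tower , sM⊑M = tower-fixpoint
          good = tower-good tower
      in M , good , base⊑ tower , proj₂ (proj₂ (s-spec M) good) sM⊑M
      where
      -- Choice asks for a total relation, so the demands on `G` are conditional on `F` being good.
      -- The clause `G ⊑ F → Maximal F` lets a good `F` be a fixpoint only if it is maximal.
      R : Subset → Subset → Set (a ⊔ g)
      R F G = F ⊑ G × (Good F → Good G × (G ⊑ F → Maximal F))

      R-resp : ∀ {F F′ G G′} → F ⊑ F′ × F′ ⊑ F → G ⊑ G′ × G′ ⊑ G → R F G → R F′ G′
      R-resp (F⊑F′ , F′⊑F) (G⊑G′ , G′⊑G) (F⊑G , extends) =
        ⊑-trans F′⊑F (⊑-trans F⊑G G⊑G′) , λ good →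
        let goodG , max = extends (Good-resp F′⊑F F⊑F′ good)
        in Good-resp G⊑G′ G′⊑G goodG , λ G′⊑F′ H goodH F′⊑H →
           ⊑-trans (max (⊑-trans G⊑G′ (⊑-trans G′⊑F′ F′⊑F)) H goodH (⊑-trans F⊑F′ F′⊑H)) F⊑F′

      R-total : ∀ F → ∃[ G ] R F G
      R-total F with em {P = ∃[ G ] Good G × F ⊑ G × ¬ (G ⊑ F)}
      ... | yes (G , good , F⊑G , G⋢F) = G , F⊑G , λ _ → good , ⊥-elim ∘ G⋢F
      ... | no none = F , (λ _ → id) , λ good → good , λ _ G goodG F⊑G → inside G goodG F⊑G
        where
        inside : Maximal F
        inside G goodG F⊑G with em {P = G ⊑ F}
        ... | yes G⊑F = G⊑F
        ... | no G⋢F  = ⊥-elim (none (G , goodG , F⊑G , G⋢F))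

      choice : Σ[ s ∈ Func subsetSetoid subsetSetoid ] (∀ F → R F (s ⟨$⟩ F))
      choice = ac subsetSetoid subsetSetoid R R-resp R-total

      s-spec : ∀ F → R F (proj₁ choice ⟨$⟩ F)
      s-spec = proj₂ choice

      open BourbakiWitt (proj₁ choice ⟨$⟩_)
        (λ F⊑G G⊑F → proj₁ (Func.cong (proj₁ choice) (F⊑G , G⊑F)))
        (proj₁ ∘ s-spec) F₀

      -- The family in a `sup` is arbitrary, but `tower-chain` makes it a chain, as `Good-⋃`
      -- requires.
      tower-good : ∀ {F} → Tower F → Good F
      tower-good base              = good₀
      tower-good (step {F} t)      = proj₁ (proj₂ (s-spec F) (tower-good t))
      tower-good (sup C inh tower) = Good-⋃ C inh
        (λ F G F∈C G∈C → tower-chain (tower F F∈C) (tower G G∈C))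
        (λ F F∈C → tower-good (tower F F∈C))

-- Filters and ultrafilters of a Boolean algebra.

module Stone (em : ∀ {ℓ} → ExcludedMiddle ℓ) (ac : AxiomOfChoice)
             {b ℓ : Level} (B : BooleanAlgebra b ℓ) where
  open BooleanAlgebra B renaming (¬_ to ~_)
  open BooleanAlgebraProperties B
    using (∧-identityʳ; ∨-identityʳ; ∨-zeroʳ; ¬-involutive; ¬⊤≈⊥; deMorgan₂)
  open BooleanSubsets em Carrier
  open SetoidReasoning setoid

  -- Upward closure is `∨-closed` together with `resp`: the elements above `x` are, up to `≈`, the
  -- joins `x ∨ y`.
  record ProperFilter (F : Subset) : Set (b ⊔ ℓ) where
    field
      resp     : ∀ {x y} → x ≈ y → T (F x) → T (F y)
      ⊤-mem    : T (F ⊤)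
      ∧-closed : ∀ {x y} → T (F x) → T (F y) → T (F (x ∧ y))
      ∨-closed : ∀ {x} y → T (F x) → T (F (x ∨ y))
      proper   : ¬ T (F ⊥)

  filter-resp : ∀ {F G} → F ⊑ G → G ⊑ F → ProperFilter F → ProperFilter G
  filter-resp F⊑G G⊑F filter = record
    { resp     = λ x≈y → F⊑G _ ∘ resp x≈y ∘ G⊑F _
    ; ⊤-mem    = F⊑G _ ⊤-mem
    ; ∧-closed = λ x∈G y∈G → F⊑G _ (∧-closed (G⊑F _ x∈G) (G⊑F _ y∈G))
    ; ∨-closed = λ y → F⊑G _ ∘ ∨-closed y ∘ G⊑F _
    ; proper   = proper ∘ G⊑F _
    } where open ProperFilter filter

  filter-⋃ : ∀ C → ∃ (T ∘ C) → Chain C → (∀ F → T (C F) → ProperFilter F) →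
             ProperFilter (⋃ C)
  filter-⋃ C (F₀ , F₀∈C) chain filter = record
    { resp     = λ x≈y x∈⋃ → let F , F∈C , x∈F = ∈⋃ C x∈⋃ in
                 ⊑⋃ C F∈C _ (resp (filter F F∈C) x≈y x∈F)
    ; ⊤-mem    = ⊑⋃ C F₀∈C _ (⊤-mem (filter F₀ F₀∈C))
    ; ∧-closed = meet
    ; ∨-closed = λ y x∈⋃ → let F , F∈C , x∈F = ∈⋃ C x∈⋃ in
                 ⊑⋃ C F∈C _ (∨-closed (filter F F∈C) y x∈F)
    ; proper   = λ ⊥∈⋃ → let F , F∈C , ⊥∈F = ∈⋃ C ⊥∈⋃ in proper (filter F F∈C) ⊥∈F
    }
    where
    open ProperFilter
    meet : ∀ {x y} → T (⋃ C x) → T (⋃ C y) → T (⋃ C (x ∧ y))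
    meet x∈⋃ y∈⋃ with F , F∈C , x∈F ← ∈⋃ C x∈⋃ | G , G∈C , y∈G ← ∈⋃ C y∈⋃
      with chain F G F∈C G∈C
    ... | inj₁ F⊑G = ⊑⋃ C G∈C _ (∧-closed (filter G G∈C) (F⊑G _ x∈F) y∈G)
    ... | inj₂ G⊑F = ⊑⋃ C F∈C _ (∧-closed (filter F F∈C) x∈F (G⊑F _ y∈G))

  Ultra : Pred Subset b
  Ultra F = ∀ x → T (F x) ⊎ T (F (~ x))

  -- If ~ x is not in F, then { y ∣ ~ x ∨ y ∈ F } is a proper filter containing
  -- F and x.
  maximal⇒ultra : ∀ {F} → ProperFilter F → Maximal ProperFilter F → Ultra F
  maximal⇒ultra {F} filter max x with em {P = T (F (~ x))}
  ... | yes ~x∈F = inj₂ ~x∈F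
  ... | no ~x∉F  = inj₁ (max G G-filter F⊑G x x∈G)
    where
    open ProperFilter filter
    G : Subset
    G y = F (~ x ∨ y)

    G-filter : ProperFilter G
    G-filter = record
      { resp     = resp ∘ ∨-congˡ
      ; ⊤-mem    = resp (sym (∨-zeroʳ _)) ⊤-mem
      ; ∧-closed = λ y∈G z∈G → resp (sym (∨-distribˡ-∧ _ _ _)) (∧-closed y∈G z∈G)
      ; ∨-closed = λ z → resp (∨-assoc _ _ _) ∘ ∨-closed z
      ; proper   = ~x∉F ∘ resp (∨-identityʳ _)
      }

    F⊑G : F ⊑ G
    F⊑G y y∈F = resp (∨-comm y (~ x)) (∨-closed (~ x) y∈F)

    x∈G : T (G x)
    x∈G = resp (sym (∨-complementˡ x)) ⊤-mem

  -- `~ x ∨ y ≈ ⊤` expresses that `x` lies below `y`. The filter is proper because only `⊥` lies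
  -- below `⊥`.
  principal-filter : ∀ {x} → ¬ (x ≈ ⊥) → ProperFilter ⟪ (λ y → ~ x ∨ y ≈ ⊤) ⟫
  principal-filter {x} x≉⊥ = record
    { resp     = λ y≈z y∈ → ⟪⟫⁺ P (trans (∨-congˡ (sym y≈z)) (⟪⟫⁻ P y∈))
    ; ⊤-mem    = ⟪⟫⁺ P (∨-zeroʳ _)
    ; ∧-closed = λ {y} {z} y∈ z∈ → ⟪⟫⁺ P (begin
        ~ x ∨ (y ∧ z)         ≈⟨ ∨-distribˡ-∧ _ _ _ ⟩
        (~ x ∨ y) ∧ (~ x ∨ z) ≈⟨ ∧-cong (⟪⟫⁻ P y∈) (⟪⟫⁻ P z∈) ⟩
        ⊤ ∧ ⊤                 ≈⟨ ∧-identityʳ ⊤ ⟩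
        ⊤                     ∎)
    ; ∨-closed = λ {y} z y∈ → ⟪⟫⁺ P (begin
        ~ x ∨ (y ∨ z) ≈⟨ ∨-assoc _ _ _ ⟨
        (~ x ∨ y) ∨ z ≈⟨ ∨-congʳ (⟪⟫⁻ P y∈) ⟩
        ⊤ ∨ z         ≈⟨ ∨-comm _ _ ⟩
        z ∨ ⊤         ≈⟨ ∨-zeroʳ z ⟩
        ⊤             ∎)
    ; proper   = λ ⊥∈ → x≉⊥ (begin
        x             ≈⟨ ¬-involutive x ⟨
        ~ (~ x)       ≈⟨ ¬-cong (∨-identityʳ (~ x)) ⟨
        ~ (~ x ∨ ⊥)   ≈⟨ ¬-cong (⟪⟫⁻ P ⊥∈) ⟩
        ~ ⊤           ≈⟨ ¬⊤≈⊥ ⟩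
        ⊥             ∎)
    }
    where
    P : Pred Carrier ℓ
    P y = ~ x ∨ y ≈ ⊤

  record Ultrafilter : Set (b ⊔ ℓ) where
    field
      mem    : Subset
      filter : ProperFilter mem
      ultra  : Ultra mem
    open ProperFilter filter public

  open Ultrafilter

  -- The ultrafilter theorem: a maximal proper filter above the principal filter of `x` is an
  -- ultrafilter that still contains `x`.
  ultrafilter-through : ∀ {x} → ¬ (x ≈ ⊥) → ∃[ U ] T (mem U x)
  ultrafilter-through {x} x≉⊥ =
    let M , filter , x⊑M , max = zorn ProperFilter ac filter-resp filter-⋃ _ (principal-filter x≉⊥)
    in record { filter = filter ; ultra = maximal⇒ultra filter max }
     , x⊑M x (⟪⟫⁺ (λ y → ~ x ∨ y ≈ ⊤) (∨-complementˡ x))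

  -- The Stone map and its image.

  consistent : ∀ U {x} → T (mem U x) → ¬ T (mem U (~ x))
  consistent U x∈U ~x∈U = proper U (resp U (∧-complementʳ _) (∧-closed U x∈U ~x∈U))

  -- Boolean-valued membership puts the Stone sets at level `0ℓ`, where `SetAlgebra` has its power
  -- set, whatever the levels of `B`.
  stone : Carrier → Pred Ultrafilter 0ℓ
  stone x U = T (mem U x)

  stone-cong : ∀ {x y} → x ≈ y → stone x ≐ stone y
  stone-cong x≈y = (λ {U} → resp U x≈y) , (λ {U} → resp U (sym x≈y))

  stone-⊥ : stone ⊥ ≐ ∅
  stone-⊥ = (λ {U} → proper U) , λ ()

  stone-~ : ∀ x → stone (~ x) ≐ ∁ (stone x)
  stone-~ x = (λ {U} ~x∈U x∈U → consistent U x∈U ~x∈U)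
            , (λ {U} x∉U → [ ⊥-elim ∘ x∉U , id ] (ultra U x))

  -- Ultrafilters are prime: if both complements were members, De Morgan would make the complement
  -- of the join a member.
  stone-∨ : ∀ x y → stone (x ∨ y) ≐ stone x ∪ stone y
  stone-∨ x y = (λ {U} → to U)
              , (λ {U} → [ ∨-closed U y , resp U (∨-comm y x) ∘ ∨-closed U x ])
    where
    to : ∀ U → T (mem U (x ∨ y)) → T (mem U x) ⊎ T (mem U y)
    to U x∨y∈U with ultra U x | ultra U y
    ... | inj₁ x∈U  | _         = inj₁ x∈U
    ... | inj₂ _    | inj₁ y∈U  = inj₂ y∈U
    ... | inj₂ ~x∈U | inj₂ ~y∈U =
      ⊥-elim (consistent U x∨y∈U (resp U (sym (deMorgan₂ x y)) (∧-closed U ~x∈U ~y∈U)))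

  -- If `x ∧ ~ y` is not `⊥`, an ultrafilter through it contains `x` but not `y`. If it is `⊥`,
  -- splitting `x` along `y ∨ ~ y` leaves `x ∧ y`.
  stone-reflects : ∀ {x y} → stone x ⊆ stone y → x ≈ x ∧ y
  stone-reflects {x} {y} x⊆y with em {P = x ∧ ~ y ≈ ⊥}
  ... | yes disjoint = begin
    x                     ≈⟨ ∧-identityʳ x ⟨
    x ∧ ⊤                 ≈⟨ ∧-congˡ (∨-complementʳ y) ⟨
    x ∧ (y ∨ ~ y)         ≈⟨ ∧-distribˡ-∨ _ _ _ ⟩
    (x ∧ y) ∨ (x ∧ ~ y)   ≈⟨ ∨-congˡ disjoint ⟩
    (x ∧ y) ∨ ⊥           ≈⟨ ∨-identityʳ _ ⟩
    x ∧ y                 ∎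
  ... | no meets with U , x∧~y∈U ← ultrafilter-through meets =
    ⊥-elim (consistent U
      -- Upward closure gives the join of `x ∧ ~ y` with `x`, which absorption turns into `x`; the
      -- next membership arises likewise for `~ y`.
      (x⊆y {U} (resp U (trans (∨-comm _ _) (∨-absorbs-∧ x (~ y))) (∨-closed U x x∧~y∈U)))
      (resp U (trans (∨-congʳ (∧-comm x (~ y))) (trans (∨-comm _ _) (∨-absorbs-∧ (~ y) x)))
        (∨-closed U (~ y) x∧~y∈U)))

  stone-injective : ∀ {x y} → stone x ≐ stone y → x ≈ y
  stone-injective {x} {y} (x⊆y , y⊆x) = begin
    x     ≈⟨ stone-reflects (λ {U} → x⊆y {U}) ⟩
    x ∧ y ≈⟨ ∧-comm x y ⟩
    y ∧ x ≈⟨ stone-reflects (λ {U} → y⊆x {U}) ⟨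
    y     ∎

  -- The clopen sets of the Stone space, taken as the image of `stone` up to `≐`. A membership proof
  -- carries a preimage, from which surjectivity of `stoneMap` is read off.
  stoneAlgebra : SetAlgebra (b ⊔ ℓ) (b ⊔ ℓ)
  stoneAlgebra = record
    { X        = Ultrafilter
    ; Member   = λ P → ∃[ x ] stone x ≐ P
    ; resp     = λ P≐Q (x , x≐P) → x , ≐-trans x≐P P≐Q
    ; ∅-closed = ⊥ , stone-⊥
    ; ∁-closed = λ (x , x⊆P , P⊆x) → ~ x , ≐-trans (stone-~ x)
        ((λ x∉ → x∉ ∘ P⊆x) , (λ ∉P → ∉P ∘ x⊆P))
    ; ∪-closed = λ (x , x⊆P , P⊆x) (y , y⊆Q , Q⊆y) → x ∨ y , ≐-trans (stone-∨ x y)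
        ( (λ { (inj₁ u) → inj₁ (x⊆P u) ; (inj₂ u) → inj₂ (y⊆Q u) })
        , (λ { (inj₁ u) → inj₁ (P⊆x u) ; (inj₂ u) → inj₂ (Q⊆y u) }))
    }

  stoneMap : Carrier → BooleanAlgebra.Carrier (setBooleanAlgebra em stoneAlgebra)
  stoneMap x = stone x , x , ≐-refl

  stoneMap-isBooleanIsomorphism :
    IsBooleanIsomorphism B (setBooleanAlgebra em stoneAlgebra) stoneMap
  stoneMap-isBooleanIsomorphism = record
    { isRelIsomorphism = record
      { isMonomorphism = record
        { isHomomorphism = record { cong = stone-cong }
        ; injective      = stone-injective
        }
      ; surjective = λ (P , x , x≐P) → x , λ z≈x → ≐-trans (stone-cong z≈x) x≐P
      }
    ; 𝟘-homo = stone-⊥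
    ; ⊖-homo = stone-~
    ; ⊕-homo = stone-∨
    }

-- Inverses of Boolean isomorphisms and preservation of the derived operations.

module BooleanIsomorphism {a ℓ b ℓ′ : Level}
  {A : BooleanAlgebra a ℓ} {B : BooleanAlgebra b ℓ′}
  {f : BooleanAlgebra.Carrier A → BooleanAlgebra.Carrier B}
  (f-iso : IsBooleanIsomorphism A B f) where
  private
    module A = BooleanAlgebra A
    module B = BooleanAlgebra B
    module NA = BooleanNotation A
    module NB = BooleanNotation B
  open IsBooleanIsomorphism f-iso public
  open IsRelIsomorphism isRelIsomorphism public using (cong; injective; surjective)
  open SetoidReasoning B.setoid

  f⁻¹ : B.Carrier → A.Carrier
  f⁻¹ y = proj₁ (surjective y)

  f∘f⁻¹ : ∀ y → f (f⁻¹ y) B.≈ y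
  f∘f⁻¹ y = proj₂ (surjective y) A.refl

  f⁻¹-unique : ∀ {x y} → f x B.≈ y → f⁻¹ y A.≈ x
  f⁻¹-unique fx≈y = injective (B.trans (f∘f⁻¹ _) (B.sym fx≈y))

  inverse-iso : IsBooleanIsomorphism B A f⁻¹
  inverse-iso = record
    { isRelIsomorphism = record
      { isMonomorphism = record
        { isHomomorphism = record { cong = λ y≈z → f⁻¹-unique (B.trans (f∘f⁻¹ _) (B.sym y≈z)) }
        ; injective      = λ {y} {z} p → B.trans (B.sym (f∘f⁻¹ y)) (B.trans (cong p) (f∘f⁻¹ z))
        }
      ; surjective = λ x → f x , λ z≈fx → f⁻¹-unique (B.sym z≈fx)
      }
    ; 𝟘-homo = f⁻¹-unique 𝟘-homo
    ; ⊖-homo = λ x → f⁻¹-unique (B.trans (⊖-homo _) (B.¬-cong (f∘f⁻¹ x)))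
    ; ⊕-homo = λ x y → f⁻¹-unique (B.trans (⊕-homo _ _) (B.∨-cong (f∘f⁻¹ x) (f∘f⁻¹ y)))
    }

  𝟙-homo : f NA.𝟙 B.≈ NB.𝟙
  𝟙-homo = B.trans (⊖-homo _) (B.¬-cong 𝟘-homo)

  ⊗-homo : ∀ x y → f (x NA.⊗ y) B.≈ f x NB.⊗ f y
  ⊗-homo x y = B.trans (⊖-homo _)
    (B.¬-cong (B.trans (⊕-homo _ _) (B.∨-cong (⊖-homo x) (⊖-homo y))))

  -- The endpoints are given up to `≈` because the two sides of a transported inequality are images
  -- under `f` only up to `≈`.
  ≤-homo : ∀ {x y x′ y′} → x′ B.≈ f x → y′ B.≈ f y → x NA.≤ y → x′ NB.≤ y′
  ≤-homo {x} {y} {x′} {y′} x′≈fx y′≈fy x≤y = begin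
    x′ NB.⇒ y′          ≈⟨ B.∨-cong (B.¬-cong x′≈fx) y′≈fy ⟩
    f x NB.⇒ f y        ≈⟨ B.∨-congʳ (⊖-homo x) ⟨
    f (NA.⊖ x) NB.⊕ f y ≈⟨ ⊕-homo _ _ ⟨
    f (x NA.⇒ y)        ≈⟨ cong x≤y ⟩
    f NA.𝟙              ≈⟨ 𝟙-homo ⟩
    NB.𝟙                ∎

-- Polynomials under a change of coefficients.

module PolynomialMaps {v : Level} (Var : Set v) where
  open Polynomials Var
  open PolynomialEquality

  eval-cong : ∀ {t ℓ} (T : BooleanAlgebra t ℓ) {ν ν′} →
              (∀ x → BooleanAlgebra._≈_ T (ν x) (ν′ x)) →
              ∀ α → BooleanAlgebra._≈_ T (eval T ν α) (eval T ν′ α)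
  eval-cong T ν≈ν′ (var x)  = ν≈ν′ x
  eval-cong T ν≈ν′ (coef a) = BooleanAlgebra.refl T
  eval-cong T ν≈ν′ (-ᵖ α)   = BooleanAlgebra.¬-cong T (eval-cong T ν≈ν′ α)
  eval-cong T ν≈ν′ (α +ᵖ β) = BooleanAlgebra.∨-cong T (eval-cong T ν≈ν′ α) (eval-cong T ν≈ν′ β)

  -- A record, because α and β cannot be inferred from the function type that
  -- =ᵖ unfolds to.
  record Equal {t ℓ : Level} (T : BooleanAlgebra t ℓ)
               (α β : Poly (BooleanAlgebra.Carrier T)) : Set (v ⊔ t ⊔ ℓ) where
    constructor pointwise
    field at : _=ᵖ_ T α β

  open Equal public

  module _ {t ℓ : Level} {T : BooleanAlgebra t ℓ} where

    ≃-sym : ∀ {α β} → Equal T α β → Equal T β α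
    ≃-sym α≃β = pointwise λ ν → BooleanAlgebra.sym T (at α≃β ν)

    ≃-trans : ∀ {α β γ} → Equal T α β → Equal T β γ → Equal T α γ
    ≃-trans α≃β β≃γ = pointwise λ ν → BooleanAlgebra.trans T (at α≃β ν) (at β≃γ ν)

  module _ {t ℓ t′ ℓ′ : Level} {T : BooleanAlgebra t ℓ} {T′ : BooleanAlgebra t′ ℓ′}
           {g : BooleanAlgebra.Carrier T → BooleanAlgebra.Carrier T′}
           (g-iso : IsBooleanIsomorphism T T′ g) where
    private
      module T = BooleanAlgebra T
      module T′ = BooleanAlgebra T′
    open BooleanIsomorphism g-iso renaming (f⁻¹ to g⁻¹; f∘f⁻¹ to g∘g⁻¹)

    eval-mapCoef : ∀ ν α → eval T′ (g ∘ ν) (mapCoef g α) T′.≈ g (eval T ν α)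
    eval-mapCoef ν (var x)  = T′.refl
    eval-mapCoef ν (coef a) = T′.refl
    eval-mapCoef ν (-ᵖ α)   = T′.trans (T′.¬-cong (eval-mapCoef ν α)) (T′.sym (⊖-homo _))
    eval-mapCoef ν (α +ᵖ β) =
      T′.trans (T′.∨-cong (eval-mapCoef ν α) (eval-mapCoef ν β)) (T′.sym (⊕-homo _ _))

    -- Equality in `T′` is tested at all valuations into `T′`. Each of them is, up to `≈`, `g` after
    -- a valuation into `T`, because `g` is surjective.
    mapCoef-cong : ∀ {α β} → Equal T α β → Equal T′ (mapCoef g α) (mapCoef g β)
    mapCoef-cong {α} {β} α=β = pointwise λ ν → begin
      eval T′ ν (mapCoef g α) ≈⟨ through-T ν α ⟩
      g (eval T (g⁻¹ ∘ ν) α)  ≈⟨ cong (at α=β (g⁻¹ ∘ ν)) ⟩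
      g (eval T (g⁻¹ ∘ ν) β)  ≈⟨ through-T ν β ⟨
      eval T′ ν (mapCoef g β) ∎
      where
      open SetoidReasoning T′.setoid
      through-T : ∀ ν γ → eval T′ ν (mapCoef g γ) T′.≈ g (eval T (g⁻¹ ∘ ν) γ)
      through-T ν γ = T′.trans (eval-cong T′ (λ x → T′.sym (g∘g⁻¹ (ν x))) (mapCoef g γ))
                               (eval-mapCoef (g⁻¹ ∘ ν) γ)

    mapCoef-inverse : ∀ α → Equal T′ (mapCoef g (mapCoef g⁻¹ α)) α
    mapCoef-inverse α = pointwise λ ν → at-valuation ν α
      where
      at-valuation : ∀ ν α → eval T′ ν (mapCoef g (mapCoef g⁻¹ α)) T′.≈ eval T′ ν α
      at-valuation ν (var x)  = T′.refl
      at-valuation ν (coef a) = g∘g⁻¹ a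
      at-valuation ν (-ᵖ α)   = T′.¬-cong (at-valuation ν α)
      at-valuation ν (α +ᵖ β) = T′.∨-cong (at-valuation ν α) (at-valuation ν β)

-- Transport of polynomial algebras along Boolean isomorphisms.

module PolynomialAlgebras (em : ∀ {ℓ} → ExcludedMiddle ℓ)
  {c v p : Level} (Const : Set c) (Var : Set v) (Prop′ : Set p) where
  open LPB em Const Var Prop′
  open PolynomialMaps Var

  module Transport
    {m t ℓt a ℓa : Level} (CS : ConstantSpecification m)
    (𝒜 : PolynomialAlgebra CS t ℓt a ℓa)
    {t′ ℓt′ a′ ℓa′ : Level}
    (T′ : BooleanAlgebra t′ ℓt′) (A′ : BooleanAlgebra a′ ℓa′)
    {g : BooleanAlgebra.Carrier (PolynomialAlgebra.T 𝒜) → BooleanAlgebra.Carrier T′}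
    {f : BooleanAlgebra.Carrier (PolynomialAlgebra.A 𝒜) → BooleanAlgebra.Carrier A′}
    (g-iso : IsBooleanIsomorphism (PolynomialAlgebra.T 𝒜) T′ g)
    (f-iso : IsBooleanIsomorphism (PolynomialAlgebra.A 𝒜) A′ f) where
    private
      module P = PolynomialAlgebra 𝒜
      module T = BooleanAlgebra P.T
      module T′ = BooleanAlgebra T′
      module A′ = BooleanAlgebra A′
      module F = BooleanIsomorphism f-iso
      module G = BooleanIsomorphism g-iso
    open Polynomials.PolynomialEquality Var T′ using () renaming (_=ᵖ_ to _=ᵖ′_)
    open F using (f⁻¹; f∘f⁻¹)
    open G using () renaming (f⁻¹ to g⁻¹)

    infix 4 _≃_ _≃′_
    _≃_ : Rel (Poly T.Carrier) _
    _≃_ = Equal P.T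

    _≃′_ : Rel (Poly T′.Carrier) _
    _≃′_ = Equal T′

    ·-cong : ∀ {α α′ β β′} → α ≃ α′ → β ≃ β′ → α P.·ᵖ β ≃ α′ P.·ᵖ β′
    ·-cong {α} {α′} {β} {β′} α≃α′ β≃β′ =
      pointwise (P.·ᵖ-cong {α} {α′} {β} {β′} (at α≃α′) (at β≃β′))

    !-cong : ∀ {α α′} → α ≃ α′ → P.!ᵖ α ≃ P.!ᵖ α′
    !-cong {α} {α′} α≃α′ = pointwise (P.!ᵖ-cong {α} {α′} (at α≃α′))

    ·-extend : ∀ x y → coef x P.·ᵖ coef y ≃ coef (x P.·ᵀ y)
    ·-extend x y = pointwise (P.·-extend x y)

    !-extend : ∀ x → P.!ᵖ (coef x) ≃ coef (P.!ᵀ x)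
    !-extend x = pointwise (P.!-extend x)

    □-cong : ∀ {α β} φ → α ≃ β → f (P.□ α φ) A′.≈ f (P.□ β φ)
    □-cong φ α≃β = F.cong (P.□-cong φ (at α≃β))

    ĝ : Poly T.Carrier → Poly T′.Carrier
    ĝ = mapCoef g

    ĝ⁻¹ : Poly T′.Carrier → Poly T.Carrier
    ĝ⁻¹ = mapCoef g⁻¹

    ĝ-cong : ∀ {α β} → α ≃ β → ĝ α ≃′ ĝ β
    ĝ-cong = mapCoef-cong g-iso

    ĝ⁻¹-cong : ∀ {α β} → α ≃′ β → ĝ⁻¹ α ≃ ĝ⁻¹ β
    ĝ⁻¹-cong = mapCoef-cong G.inverse-iso

    -- The inverse extracted from `G.inverse-iso` is `g` by definition, since its surjectivity proof
    -- returns the image under `g`.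
    ĝ⁻¹∘ĝ : ∀ α → ĝ⁻¹ (ĝ α) ≃ α
    ĝ⁻¹∘ĝ = mapCoef-inverse G.inverse-iso

    -- The polynomial operations need not act coefficientwise, so they are conjugated as a whole.
    -- The extension laws carry over because `ĝ⁻¹ (coef x)` is `coef (g⁻¹ x)` by definition.
    operations : PolynomialOperations T′
    operations = record
      { _·ᵀ_     = λ x y → g (g⁻¹ x P.·ᵀ g⁻¹ y)
      ; !ᵀ       = λ x → g (P.!ᵀ (g⁻¹ x))
      ; ·ᵀ-cong  = λ x≈x′ y≈y′ → G.cong (P.·ᵀ-cong (g⁻¹-cong x≈x′) (g⁻¹-cong y≈y′))
      ; !ᵀ-cong  = λ x≈x′ → G.cong (P.!ᵀ-cong (g⁻¹-cong x≈x′))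
      ; _·ᵖ_     = λ α β → ĝ (ĝ⁻¹ α P.·ᵖ ĝ⁻¹ β)
      ; !ᵖ       = λ α → ĝ (P.!ᵖ (ĝ⁻¹ α))
      ; ·ᵖ-cong  = λ {α} {α′} {β} {β′} α=α′ β=β′ → at (ĝ-cong (·-cong
          (ĝ⁻¹-cong (pointwise {α = α} {α′} α=α′)) (ĝ⁻¹-cong (pointwise {α = β} {β′} β=β′))))
      ; !ᵖ-cong  = λ {α} {α′} α=α′ → at (ĝ-cong (!-cong (ĝ⁻¹-cong (pointwise {α = α} {α′} α=α′))))
      ; ·-extend = λ x y → at (ĝ-cong (·-extend (g⁻¹ x) (g⁻¹ y)))
      ; !-extend = λ x → at (ĝ-cong (!-extend (g⁻¹ x)))
      }
      where open BooleanIsomorphism G.inverse-iso using () renaming (cong to g⁻¹-cong)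

    preStructure : PrePolynomialStructure CS operations A′
    preStructure = record
      { I       = g ∘ P.I
      ; □       = λ α φ → f (P.□ (ĝ⁻¹ α) φ)
      ; □-cong  = λ {α} {β} φ α=β → □-cong φ (ĝ⁻¹-cong (pointwise {α = α} {β} α=β))
      ; I-𝟎     = T′.trans (G.cong P.I-𝟎) G.𝟘-homo
      -- The conjugated product leaves a round trip through `ĝ` to cancel, whereas in `□-sum` the
      -- map `ĝ⁻¹` commutes with `+ᵖ` by definition.
      ; □-app   = λ α β φ ψ → F.≤-homo (A′.sym (F.⊗-homo _ _))
          (□-cong ψ (ĝ⁻¹∘ĝ (ĝ⁻¹ α P.·ᵖ ĝ⁻¹ β))) (P.□-app (ĝ⁻¹ α) (ĝ⁻¹ β) φ ψ)
      ; □-sum   = λ α β φ → F.≤-homo (A′.sym (F.⊕-homo _ _)) A′.refl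
          (P.□-sum (ĝ⁻¹ α) (ĝ⁻¹ β) φ)
      ; □-nec   = λ {φ} ⊢φ → A′.trans
          (□-cong φ (pointwise λ _ → BooleanIsomorphism.𝟙-homo G.inverse-iso))
          (A′.trans (F.cong (P.□-nec ⊢φ)) F.𝟙-homo)
      ; □-const = λ {k} {φ} kφ∈CS → A′.trans (□-cong φ (ĝ⁻¹∘ĝ (coef (P.I (just k)))))
          (A′.trans (F.cong (P.□-const kφ∈CS)) F.𝟙-homo)
      }

    private module P′ = PrePolynomialStructure preStructure

    -- Induction on terms: `ĝ⁻¹` commutes with `-ᵖ` and `+ᵖ` by definition; in the cases of
    -- constants, `·` and `!` a round trip through `ĝ` is cancelled.
    Ĩ-homo : ∀ s → ĝ⁻¹ (P′.Ĩ s) ≃ P.Ĩ s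
    Ĩ-homo (con k) = ĝ⁻¹∘ĝ (coef (P.I (just k)))
    Ĩ-homo (var x) = pointwise λ _ → T.refl
    Ĩ-homo 𝟎       = ĝ⁻¹∘ĝ (coef (P.I nothing))
    Ĩ-homo (- s)   = pointwise λ ν → T.¬-cong (at (Ĩ-homo s) ν)
    Ĩ-homo (s + u) = pointwise λ ν → T.∨-cong (at (Ĩ-homo s) ν) (at (Ĩ-homo u) ν)
    Ĩ-homo (s · u) = ≃-trans (ĝ⁻¹∘ĝ _) (·-cong (Ĩ-homo s) (Ĩ-homo u))
    Ĩ-homo (! s)   = ≃-trans (ĝ⁻¹∘ĝ _) (!-cong (Ĩ-homo s))

    -- Each algebra decides `s ≋ u` by its own equality of polynomials, so agreement of truth values
    -- takes this direction and its converse `Ĩ-preserves`.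
    Ĩ-reflects : ∀ s u → P′.Ĩ s ≃′ P′.Ĩ u → P.Ĩ s ≃ P.Ĩ u
    Ĩ-reflects s u s≃u = ≃-trans (≃-sym (Ĩ-homo s)) (≃-trans (ĝ⁻¹-cong s≃u) (Ĩ-homo u))

    Ĩ-preserves : ∀ s u → P.Ĩ s ≃ P.Ĩ u → P′.Ĩ s ≃′ P′.Ĩ u
    Ĩ-preserves s u s≃u = ≃-trans (image s) (≃-trans (ĝ-cong s≃u) (≃-sym (image u)))
      where
      image : ∀ w → P′.Ĩ w ≃′ ĝ (P.Ĩ w)
      image w = ≃-trans (≃-sym (mapCoef-inverse g-iso (P′.Ĩ w))) (ĝ-cong (Ĩ-homo w))

    -- Induction on formulas. The value of `s ∶ φ` depends on the index and on `φ` as a syntactic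
    -- object, so that case rests on `Ĩ-homo` and not on an induction hypothesis.
    ⟦⟧-homo : ∀ φ θ → P′.⟦ φ ⟧ θ A′.≈ f (P.⟦ φ ⟧ (f⁻¹ ∘ θ))
    ⟦⟧-homo (atom q) θ = A′.sym (f∘f⁻¹ (θ q))
    ⟦⟧-homo (s ≋ u)  θ with em {P = P′.Ĩ s =ᵖ′ P′.Ĩ u} | em {P = P.Ĩ s P.=ᵖ P.Ĩ u}
    ... | yes _   | yes _   = A′.sym F.𝟙-homo
    ... | yes s=u | no s≠u  = ⊥-elim (s≠u (at (Ĩ-reflects s u (pointwise s=u))))
    ... | no s≠u  | yes s=u = ⊥-elim (s≠u (at (Ĩ-preserves s u (pointwise s=u))))
    ... | no _    | no _    = A′.sym F.𝟘-homo
    ⟦⟧-homo ⊥ᶠ       θ = A′.sym F.𝟘-homo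
    ⟦⟧-homo (¬ᶠ φ)   θ = A′.trans (A′.¬-cong (⟦⟧-homo φ θ)) (A′.sym (F.⊖-homo _))
    ⟦⟧-homo (φ ∨ᶠ ψ) θ =
      A′.trans (A′.∨-cong (⟦⟧-homo φ θ) (⟦⟧-homo ψ θ)) (A′.sym (F.⊕-homo _ _))
    ⟦⟧-homo (s ∶ φ)  θ = □-cong φ (Ĩ-homo s)

    structure : PolynomialStructure CS operations A′
    structure = record
      { prePolynomialStructure = preStructure
      ; □-introsp = λ s φ → F.≤-homo
          (□-cong φ (Ĩ-homo s))
          -- The index `!ᵖ (Ĩ s)` is `Ĩ (! s)` by definition, so `Ĩ-homo` applies to the term `! s`.
          (□-cong (s ∶ φ) (Ĩ-homo (! s)))
          (P.□-introsp s φ)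
      ; □-reflect = λ α φ θ → F.≤-homo A′.refl (⟦⟧-homo φ θ) (P.□-reflect (ĝ⁻¹ α) φ (f⁻¹ ∘ θ))
      }

    biIsomorphism : BiIsomorphism CS 𝒜 (record { polynomialStructure = structure })
    biIsomorphism = record
      { f = f
      ; g = g
      ; f-isBooleanIsomorphism = f-iso
      ; g-isBooleanIsomorphism = g-iso
      ; □-homo = λ α φ → A′.sym (□-cong φ (ĝ⁻¹∘ĝ α))
      ; I-homo = λ _ → T′.refl
      ; ·-homo = λ α β → at (ĝ-cong (≃-sym (·-cong (ĝ⁻¹∘ĝ α) (ĝ⁻¹∘ĝ β))))
      ; !-homo = λ α → at (ĝ-cong (≃-sym (!-cong (ĝ⁻¹∘ĝ α))))
      }

theorem6p13 : (em : ∀ {ℓ} → ExcludedMiddle ℓ) → AxiomOfChoice →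
    ∀ {c v p m t ℓt a ℓa : Level} (Const : Set c) (Var : Set v) (Prop′ : Set p) →
    let open LPB em Const Var Prop′ in
    (CS : ConstantSpecification m) (𝒜 : PolynomialAlgebra CS t ℓt a ℓa) →
    Σ[ ℬ ∈ PolynomialSetAlgebra CS (t ⊔ ℓt) (t ⊔ ℓt) (a ⊔ ℓa) (a ⊔ ℓa) ]
    BiIsomorphism CS 𝒜 (PolynomialSetAlgebra.polynomialAlgebra ℬ)
theorem6p13 em ac Const Var Prop′ CS 𝒜 =
  record { polynomialStructure = structure } , biIsomorphism
  where
  module P = LPB.PolynomialAlgebra {em = em} {Const = Const} {Var} {Prop′} 𝒜
  open Stone em ac
  open PolynomialAlgebras.Transport em Const Var Prop′ CS 𝒜
    (setBooleanAlgebra em (stoneAlgebra P.T)) (setBooleanAlgebra em (stoneAlgebra P.A))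
    (stoneMap-isBooleanIsomorphism P.T) (stoneMap-isBooleanIsomorphism P.A)
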